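{- For any constant specification $\mathsf{CS}$ for $\mathsf{JD}$, the logic $\mathsf{JD}_{\mathsf{CS}}$ proves every instance of the axiom scheme (noc), i.e. $\mathsf{JD}_{\mathsf{CS}}\vdash\neg(t:A\land t:\neg A)$ for all terms $t$ and all formulas $A$.
   Context: Justification terms are built from countably many constants $c_i$ and countably many variables $x_i$ by $t::=c_i\mid x_i\mid t\cdot t\mid (t+t)\mid\, !t$. Formulas are built from countably many atomic propositions $P_i$ and $\perp$ by $F::=P_i\mid\perp\mid F\to F\mid t:F$; the set of formulas is $\mathcal{L}_J$. The other Boolean connectives are defined as usual from $\to,\perp$; in particular $\neg A:=A\to\perp$ and $\top:=\neg\perp$. The axioms of $\mathsf{JD}$ are (for all terms $s,t$ and formulas $A,B$): (cl) all axioms of classical propositional logic (in the language $\mathcal{L}_J$); (j+) $s:A\lor t:A\to (s+t):A$; (j) $s:(A\to B)\to(t:A\to s\cdot t:B)$; (jd) $\neg(t:\perp)$. A constant specification for $\mathsf{JD}$ is a set $\mathsf{CS}\subseteq\{(c,A)\mid c\text{ a constant and }A\text{ an axiom of }\mathsf{JD}\}$. Write $!^n c$ for $c$ prefixed by $n$ copies of $!$. The logic $\mathsf{JD}_{\mathsf{CS}}$ is given by the axioms of $\mathsf{JD}$ and the rules modus ponens (from $A$ and $A\to B$ infer $B$) and axiom necessitation: for every $(c,A)\in\mathsf{CS}$ and $n\in\mathbb{N}$ (including $n=0$), infer $!^n c:\,!^{n-1}c:\cdots:\,!c:c:A$ (for $n=0$ this is $c:A$). $\mathsf{JD}_{\mathsf{CS}}\vdash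 F$ means $F$ is derivable. -}

module Defs where

open import Data.Nat using (ℕ; zero; suc)
open import Data.Product using (_×_; _,_)
open import Level using (0ℓ)
open import Relation.Unary using (Pred; _∈_; _⊆_)

infixl 9 _·_
infixl 8 _⊕_
infix  10 !_

data Term : Set where
  const : ℕ → Term
  var   : ℕ → Term
  _·_   : Term → Term → Term
  _⊕_   : Term → Term → Term
  !_    : Term → Term

infixr 7 _⦂_ ~_
infixr 5 _∧_
infixr 4 _∨_
infixr 3 _⇒_

data Formula : Set where
  atom : ℕ → Formula
  ⊥    : Formula
  _⇒_  : Formula → Formula → Formula
  _⦂_  : Term → Formula → Formula

~_ : Formula → Formula
~ A = A ⇒ ⊥

_∨_ : Formula → Formula → Formula
A ∨ B = ~ A ⇒ B

_∧_ : Formula → Formula → Formula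
A ∧ B = ~ (A ⇒ ~ B)

-- A Hilbert-style axiomatisation of classical propositional logic, complete
-- (with modus ponens) for the primitive connectives ⇒ and ⊥.  Atoms and
-- formulas t ⦂ A alike may occur in the instances.
data ClassicalAxiom : Pred Formula 0ℓ where
  k   : ∀ A B   → ClassicalAxiom (A ⇒ B ⇒ A)
  s   : ∀ A B C → ClassicalAxiom ((A ⇒ B ⇒ C) ⇒ (A ⇒ B) ⇒ A ⇒ C)
  dne : ∀ A     → ClassicalAxiom (~ ~ A ⇒ A)

data Axiom : Pred Formula 0ℓ where
  cl : ∀ {A} → ClassicalAxiom A → Axiom A
  j+ : ∀ s t A → Axiom (s ⦂ A ∨ t ⦂ A ⇒ (s ⊕ t) ⦂ A)
  j  : ∀ s t A B → Axiom (s ⦂ (A ⇒ B) ⇒ t ⦂ A ⇒ s · t ⦂ B)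
  jd : ∀ t → Axiom (~ (t ⦂ ⊥))

-- The pair (i , A) stands for (const i , A).
IsConstantSpecification : ∀ {ℓ} → Pred (ℕ × Formula) ℓ → Set ℓ
IsConstantSpecification CS = CS ⊆ λ (_ , A) → A ∈ Axiom

!^ : ℕ → Term → Term
!^ zero    t = t
!^ (suc n) t = ! (!^ n t)

-- iterated n c A is  !ⁿc ⦂ !ⁿ⁻¹c ⦂ ⋯ ⦂ !c ⦂ c ⦂ A.
iterated : ℕ → ℕ → Formula → Formula
iterated zero    c A = const c ⦂ A
iterated (suc n) c A = !^ (suc n) (const c) ⦂ iterated n c A

infix 2 JD[_]⊢_

data JD[_]⊢_ {ℓ} (CS : Pred (ℕ × Formula) ℓ) : Formula → Set ℓ where
  axiom : ∀ {A} → A ∈ Axiom → JD[ CS ]⊢ A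
  mp    : ∀ {A B} → JD[ CS ]⊢ A → JD[ CS ]⊢ A ⇒ B → JD[ CS ]⊢ B
  an    : ∀ {c A} → (c , A) ∈ CS → ∀ n → JD[ CS ]⊢ iterated n c A

{-# OPTIONS --safe #-}
module Submission where

open import Data.Nat using (ℕ)
open import Data.Product using (_×_)
open import Relation.Unary using (Pred)
open import Defs

-- Since ~ A is A ⇒ ⊥, application (j) turns t ⦂ ~ A and t ⦂ A into t · t ⦂ ⊥,
-- which (jd) refutes; the rest is propositional.

module _ {ℓ} {CS : Pred (ℕ × Formula) ℓ} where

  weaken : ∀ {A B} → JD[ CS ]⊢ B → JD[ CS ]⊢ A ⇒ B
  weaken b = mp b (axiom (cl (k _ _)))

  distribute : ∀ {A B C} → JD[ CS ]⊢ A ⇒ B ⇒ C → JD[ CS ]⊢ (A ⇒ B) ⇒ A ⇒ C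
  distribute f = mp f (axiom (cl (s _ _ _)))

  ⇒-refl : ∀ {A} → JD[ CS ]⊢ A ⇒ A
  ⇒-refl {A} = mp (axiom (cl (k A A))) (distribute (axiom (cl (k A (A ⇒ A)))))

  ⇒-trans : ∀ {A B C} → JD[ CS ]⊢ A ⇒ B → JD[ CS ]⊢ B ⇒ C → JD[ CS ]⊢ A ⇒ C
  ⇒-trans f g = mp f (distribute (weaken g))

  ⇒-swap : ∀ {A B C} → JD[ CS ]⊢ A ⇒ B ⇒ C → JD[ CS ]⊢ B ⇒ A ⇒ C
  ⇒-swap f = ⇒-trans (axiom (cl (k _ _))) (distribute f)

  ~~-intro : ∀ {A} → JD[ CS ]⊢ A → JD[ CS ]⊢ ~ ~ A
  -- `⇒-refl` at `~ A` reads `~ A ⇒ A ⇒ ⊥`: modus ponens under the assumption `~ A`.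
  ~~-intro a = mp (weaken a) (distribute ⇒-refl)

  ⦂~-refutes-⦂ : ∀ t A → JD[ CS ]⊢ t ⦂ ~ A ⇒ ~ (t ⦂ A)
  ⦂~-refutes-⦂ t A =
    -- Under the assumption `t ⦂ A`, (jd) turns the conclusion `t · t ⦂ ⊥` of (j) into `⊥`.
    ⇒-trans (axiom (j t t A ⊥)) (distribute (weaken (axiom (jd (t · t)))))

corollary19 : ∀ {ℓ} (CS : Pred (ℕ × Formula) ℓ) → IsConstantSpecification CS →
    ∀ (t : Term) (A : Formula) → JD[ CS ]⊢ ~ (t ⦂ A ∧ t ⦂ ~ A)
-- As `X ∧ Y` abbreviates `~ (X ⇒ ~ Y)`, the goal is literally the double negation of
-- `t ⦂ A ⇒ ~ (t ⦂ ~ A)`; the swap puts the two assumptions in that order.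
corollary19 CS _ t A = ~~-intro (⇒-swap (⦂~-refutes-⦂ t A))
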